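{- Suppose that $Q_0(z,u)$, $Q_1(z,u)$ and $Q_2(z,u)$ are polynomials in $z$ and $u$ with non-negative coefficients, and let $M(z,u)$ be the power series solution of $$M(z,u) = Q_0(z,u) + z\, M(z,u)\, Q_1(z,u) + z\,\frac{M(z,u)-M(z,0)}{u}\, Q_2(z,u).$$ Furthermore let $u(z)$ be the power series solution of the equation $$u(z) = zQ_2(z,u(z)) + z\,u(z)\,Q_1(z,u(z)), \qquad u(0)=0.$$ Then $M(z,0)$ is given by $$M(z,0) = \frac{Q_0(z,u(z))}{1-zQ_1(z,u(z))}.$$
   Context: The variable $u$ is called a catalytic variable. The displayed functional equation has a unique power series solution $M(z,u)$ (a formal power series in $z$ whose coefficients are polynomials in $u$), and the equation for $u(z)$ has a unique power series solution with $u(0)=0$. -}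

module Defs where

open import Level using (_⊔_)
open import Algebra.Bundles using (CommutativeRing)
open import Algebra.Bundles.Raw using (RawRing)
import Algebra.Definitions.RawMonoid as RawMonoidDefinitions
import Algebra.Properties.Ring as RingProperties
open import Data.Fin.Base using (toℕ)
open import Data.List.Base using (List; []; _∷_; map; foldr; drop)
open import Data.List.Relation.Unary.All using (All)
open import Data.Nat.Base using (ℕ; zero; suc; _∸_)
open import Relation.Binary.Core using (Rel)
open import Relation.Binary.Structures using (IsPartialOrder)
import Relation.Binary.Reasoning.Setoid as SetoidReasoning

-- The order is only required to be partial, because the order of the
-- real numbers is not constructively total.
record OrderedCommutativeRing c ℓ₁ ℓ₂ : Set (Level.suc (c ⊔ ℓ₁ ⊔ ℓ₂)) where
  infix 4 _≤_
  field
    commutativeRing : CommutativeRing c ℓ₁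
  open CommutativeRing commutativeRing public
  field
    _≤_            : Rel Carrier ℓ₂
    isPartialOrder : IsPartialOrder _≈_ _≤_
    +-mono-≤       : ∀ {w x y z} → w ≤ x → y ≤ z → w + y ≤ x + z
    *-nonNegative  : ∀ {x y} → 0# ≤ x → 0# ≤ y → 0# ≤ x * y

-- Polynomials in one indeterminate over A: coefficient lists, lowest
-- degree first, identified when they differ by trailing zeros.
module Polynomial {a ℓ} (A : RawRing a ℓ) where
  private module A = RawRing A

  infix  4 _≈_
  infixl 6 _+_ _-_
  infixl 7 _*_

  Carrier : Set a
  Carrier = List A.Carrier

  coeff : Carrier → ℕ → A.Carrier
  coeff []      _       = A.0#
  coeff (x ∷ _) zero    = x
  coeff (_ ∷ p) (suc n) = coeff p n

  _≈_ : Rel Carrier ℓ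
  p ≈ q = ∀ n → coeff p n A.≈ coeff q n

  const : A.Carrier → Carrier
  const x = x ∷ []

  indeterminate : Carrier
  indeterminate = A.0# ∷ A.1# ∷ []

  _+_ : Carrier → Carrier → Carrier
  []      + q       = q
  (x ∷ p) + []      = x ∷ p
  (x ∷ p) + (y ∷ q) = (x A.+ y) ∷ (p + q)

  -_ : Carrier → Carrier
  -_ = map A.-_

  _-_ : Carrier → Carrier → Carrier
  p - q = p + (- q)

  _*_ : Carrier → Carrier → Carrier
  []      * q = []
  (x ∷ p) * q = map (x A.*_) q + (A.0# ∷ (p * q))

  rawRing : RawRing a ℓ
  rawRing = record
    { Carrier = Carrier ; _≈_ = _≈_ ; _+_ = _+_ ; _*_ = _*_ ; -_ = -_
    ; 0# = [] ; 1# = const A.1# }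

  -- The value at x ∈ B of the polynomial whose coefficients are mapped
  -- to B by φ.
  eval₂ : ∀ {b ℓ′} (B : RawRing b ℓ′) → let module B = RawRing B in
          (A.Carrier → B.Carrier) → B.Carrier → Carrier → B.Carrier
  eval₂ B φ x = foldr (λ y v → φ y B.+ x B.* v) B.0#
    where module B = RawRing B

  eval : A.Carrier → Carrier → A.Carrier
  eval = eval₂ A (λ x → x)

  -- A quotient only if the constant coefficient is zero; see
  -- divideByIndeterminate-correct.
  divideByIndeterminate : Carrier → Carrier
  divideByIndeterminate = drop 1

-- Formal power series in one indeterminate z over A.
module PowerSeries {a ℓ} (A : RawRing a ℓ) where
  private
    module A = RawRing A
    open RawMonoidDefinitions A.+-rawMonoid using (sum)

  infix  4 _≈_
  infixl 6 _+_ _-_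
  infixl 7 _*_ _/_

  Carrier : Set a
  Carrier = ℕ → A.Carrier

  _≈_ : Rel Carrier ℓ
  f ≈ g = ∀ n → f n A.≈ g n

  0# : Carrier
  0# _ = A.0#

  const : A.Carrier → Carrier
  const x zero    = x
  const x (suc _) = A.0#

  1# : Carrier
  1# = const A.1#

  z : Carrier
  z 1 = A.1#
  z _ = A.0#

  _+_ : Carrier → Carrier → Carrier
  (f + g) n = f n A.+ g n

  -_ : Carrier → Carrier
  (- f) n = A.- f n

  _-_ : Carrier → Carrier → Carrier
  f - g = f + (- g)

  _*_ : Carrier → Carrier → Carrier
  (f * g) n = sum {suc n} (λ i → f (toℕ i) A.* g (n ∸ toℕ i))

  rawRing : RawRing a ℓ
  rawRing = record
    { Carrier = Carrier ; _≈_ = _≈_ ; _+_ = _+_ ; _*_ = _*_ ; -_ = -_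
    ; 0# = 0# ; 1# = 1# }

  -- Long division by a series g with constant term 1; a quotient only in
  -- that case, see /-correct.
  _/_ : Carrier → Carrier → Carrier
  (f / g) zero    = f 0
  (f / g) (suc n) = ((λ k → f (suc k) A.+ (A.- (f 0 A.* g (suc k)))) / g) n

-- Here R[u]⟦z⟧ and R⟦z⟧ are rings of power series in z, and R[u][z] is the
-- ring of polynomials in z with coefficients in R[u].
module Catalytic {c ℓ₁ ℓ₂} (R : OrderedCommutativeRing c ℓ₁ ℓ₂) where
  open OrderedCommutativeRing R using (Carrier; _≤_; 0#; rawRing)

  module R[u]    = Polynomial rawRing
  module R[u][z] = Polynomial R[u].rawRing
  module R[u]⟦z⟧ = PowerSeries R[u].rawRing
  module R⟦z⟧    = PowerSeries rawRing

  NonNegative : R[u][z].Carrier → Set (c ⊔ ℓ₂)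
  NonNegative = All (All (0# ≤_))

  toSeries : R[u][z].Carrier → R[u]⟦z⟧.Carrier
  toSeries = R[u][z].coeff

  -- F(z,0)
  at-u=0 : R[u]⟦z⟧.Carrier → R⟦z⟧.Carrier
  at-u=0 F n = R[u].eval 0# (F n)

  -- The inclusion of R⟦z⟧ into R[u]⟦z⟧.
  constant-in-u : R⟦z⟧.Carrier → R[u]⟦z⟧.Carrier
  constant-in-u f n = R[u].const (f n)

  -- (F(z,u) - F(z,0)) / u
  Δ : R[u]⟦z⟧.Carrier → R[u]⟦z⟧.Carrier
  Δ F n = R[u].divideByIndeterminate
            ((F R[u]⟦z⟧.- constant-in-u (at-u=0 F)) n)

  -- Q(z,w(z))
  substitute : R[u][z].Carrier → R⟦z⟧.Carrier → R⟦z⟧.Carrier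
  substitute Q w =
    R[u][z].eval₂ R⟦z⟧.rawRing
      (R[u].eval₂ R⟦z⟧.rawRing R⟦z⟧.const w) R⟦z⟧.z Q

module Correctness {c ℓ₁ ℓ₂} (R : OrderedCommutativeRing c ℓ₁ ℓ₂) where
  open OrderedCommutativeRing R
  open RingProperties ring using (-0#≈0#)
  open SetoidReasoning setoid
  open Catalytic R

  private
    module P = R[u]
    module S = R⟦z⟧

    cancel : ∀ x y → x + (y + - x) ≈ y
    cancel x y = begin
      x + (y + - x)  ≈⟨ +-congˡ (+-comm y (- x)) ⟩
      x + (- x + y)  ≈⟨ +-assoc x (- x) y ⟨
      x + - x + y    ≈⟨ +-congʳ (-‿inverseʳ x) ⟩
      0# + y         ≈⟨ +-identityˡ y ⟩
      y              ∎

    coeff-+ : ∀ p q n → P.coeff (p P.+ q) n ≈ P.coeff p n + P.coeff q n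
    coeff-+ []      q       n       = sym (+-identityˡ _)
    coeff-+ (x ∷ p) []      n       = sym (+-identityʳ _)
    coeff-+ (x ∷ p) (y ∷ q) zero    = refl
    coeff-+ (x ∷ p) (y ∷ q) (suc n) = coeff-+ p q n

    coeff-scale : ∀ x p n → P.coeff (map (x *_) p) n ≈ x * P.coeff p n
    coeff-scale x []      n       = sym (zeroʳ x)
    coeff-scale x (y ∷ p) zero    = refl
    coeff-scale x (y ∷ p) (suc n) = coeff-scale x p n

    coeff-0∷ : ∀ {p q} → p P.≈ q → (0# ∷ p) P.≈ (0# ∷ q)
    coeff-0∷ p≈q zero    = refl
    coeff-0∷ p≈q (suc n) = p≈q n

    one-* : ∀ p → (P.const 1# P.* p) P.≈ p
    one-* p n = begin
      P.coeff (map (1# *_) p P.+ (0# ∷ [])) n        ≈⟨ coeff-+ (map (1# *_) p) _ n ⟩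
      P.coeff (map (1# *_) p) n + P.coeff (0# ∷ []) n ≈⟨ +-cong (coeff-scale 1# p n) (coeff-zero n) ⟩
      1# * P.coeff p n + 0#                           ≈⟨ +-identityʳ _ ⟩
      1# * P.coeff p n                                ≈⟨ *-identityˡ _ ⟩
      P.coeff p n                                     ∎
      where
      coeff-zero : (0# ∷ []) P.≈ []
      coeff-zero zero    = refl
      coeff-zero (suc _) = refl

    u-* : ∀ p → (P.indeterminate P.* p) P.≈ (0# ∷ p)
    u-* p n = begin
      P.coeff (map (0# *_) p P.+ (0# ∷ (P.const 1# P.* p))) n
        ≈⟨ coeff-+ (map (0# *_) p) _ n ⟩
      P.coeff (map (0# *_) p) n + P.coeff (0# ∷ (P.const 1# P.* p)) n
        ≈⟨ +-cong (trans (coeff-scale 0# p n) (zeroˡ _)) (coeff-0∷ {P.const 1# P.* p} {p} (one-* p) n) ⟩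
      0# + P.coeff (0# ∷ p) n
        ≈⟨ +-identityˡ _ ⟩
      P.coeff (0# ∷ p) n
        ∎

  divideByIndeterminate-correct :
    ∀ p → P.coeff p 0 ≈ 0# →
    (P.indeterminate P.* P.divideByIndeterminate p) P.≈ p
  divideByIndeterminate-correct p p₀≈0 n =
    trans (u-* (P.divideByIndeterminate p) n) (lemma p p₀≈0 n)
    where
    lemma : ∀ p → P.coeff p 0 ≈ 0# → (0# ∷ P.divideByIndeterminate p) P.≈ p
    lemma []      _    zero    = refl
    lemma []      _    (suc _) = refl
    lemma (x ∷ p) x≈0 zero    = sym x≈0
    lemma (x ∷ p) _    (suc _) = refl

  Δ-correct :
    ∀ F n → (P.indeterminate P.* Δ F n)
              P.≈ ((F R[u]⟦z⟧.- constant-in-u (at-u=0 F)) n)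
  Δ-correct F n = divideByIndeterminate-correct
    ((F R[u]⟦z⟧.- constant-in-u (at-u=0 F)) n) (lemma (F n))
    where
    lemma : ∀ p → P.coeff (p P.- P.const (P.eval 0# p)) 0 ≈ 0#
    lemma []      = -0#≈0#
    lemma (x ∷ p) = begin
      x + - (x + 0# * P.eval 0# p) ≈⟨ +-congˡ (-‿cong (+-congˡ (zeroˡ _))) ⟩
      x + - (x + 0#)               ≈⟨ +-congˡ (-‿cong (+-identityʳ x)) ⟩
      x + - x                      ≈⟨ -‿inverseʳ x ⟩
      0#                           ∎

  /-correct : ∀ f g → g 0 ≈ 1# → ((f S./ g) S.* g) S.≈ f
  /-correct f g g₀≈1 zero = begin
    f 0 * g 0 + 0#  ≈⟨ +-identityʳ _ ⟩
    f 0 * g 0       ≈⟨ *-congˡ g₀≈1 ⟩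
    f 0 * 1#        ≈⟨ *-identityʳ _ ⟩
    f 0             ∎
  /-correct f g g₀≈1 (suc n) = begin
    f 0 * g (suc n) + ((rest S./ g) S.* g) n
      ≈⟨ +-congˡ (/-correct rest g g₀≈1 n) ⟩
    f 0 * g (suc n) + (f (suc n) + - (f 0 * g (suc n)))
      ≈⟨ cancel _ _ ⟩
    f (suc n)
      ∎
    where
    rest : S.Carrier
    rest k = f (suc k) + - (f 0 * g (suc k))

  1-zf-constant-term : ∀ f → (S.1# S.- (S.z S.* f)) 0 ≈ 1#
  1-zf-constant-term f = begin
    1# + - (0# * f 0 + 0#)  ≈⟨ +-congˡ (-‿cong (trans (+-identityʳ _) (zeroˡ _))) ⟩
    1# + - 0#               ≈⟨ +-congˡ -0#≈0# ⟩
    1# + 0#                 ≈⟨ +-identityʳ 1# ⟩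
    1#                      ∎

{-# OPTIONS --safe #-}
-- The kernel method.  Substituting the series u(z) for u is a ring
-- homomorphism F ↦ F(z,u(z)) from R[u]⟦z⟧ to R⟦z⟧; it turns the functional
-- equation into a linear relation between m = M(z,u(z)), d = ΔM(z,u(z)) and
-- M(z,0), where m = u(z) d + M(z,0).  Since u(z) is a root of the kernel, d
-- drops out and M(z,0) = Q₀ + z M(z,0) Q₁ remains (at u = u(z)).
module Submission where

open import Defs

open import Algebra.Bundles using (CommutativeRing)
open import Algebra.Bundles.Raw using (RawRing)
open import Algebra.Morphism.Structures using (module RingMorphisms)
import Algebra.Properties.CommutativeSemigroup as CommutativeSemigroupProperties
import Algebra.Properties.Group as GroupProperties
import Algebra.Properties.Ring as RingProperties
import Algebra.Solver.Ring.NaturalCoefficients.Default as RingSolver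
open import Algebra.Structures using (IsCommutativeRing)
open import Data.List.Base using ([]; _∷_; map)
open import Data.Nat.Base using (zero; suc)
open import Data.Product.Base using (_,_)
open import Function.Base using (_∘_)
import Relation.Binary.Reasoning.Setoid as SetoidReasoning

-- The commutative ring of formal power series, and uniqueness of quotients.

module PowerSeriesProperties {a ℓ} (A : CommutativeRing a ℓ) where
  open CommutativeRing A
  open CommutativeSemigroupProperties +-commutativeSemigroup
    using (interchange; xy∙z≈xz∙y)
  open RingProperties ring using (-0#≈0#)
  open SetoidReasoning setoid
  private module S = PowerSeries rawRing

  scale : Carrier → S.Carrier → S.Carrier
  scale x f n = x * f n

  -- Multiplication by `S.z`, as `z-*` shows, in a form that computes by cases on the index.
  shift : S.Carrier → S.Carrier
  shift f zero    = 0#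
  shift f (suc n) = f n

  -- At `suc n` the convolution sum reduces definitionally to
  -- `f 0 * g (suc n) + ((f ∘ suc) S.* g) n`. Inductions on the index therefore replace the left
  -- factor by its tail and keep the right factor.
  *-cong′ : ∀ {f f′ g g′} → f S.≈ f′ → g S.≈ g′ → (f S.* g) S.≈ (f′ S.* g′)
  *-cong′ p q zero    = +-congʳ (*-cong (p 0) (q 0))
  *-cong′ p q (suc n) = +-cong (*-cong (p 0) (q (suc n))) (*-cong′ (p ∘ suc) q n)

  *-zeroˡ : ∀ g → (S.0# S.* g) S.≈ S.0#
  *-zeroˡ g zero    = trans (+-identityʳ _) (zeroˡ _)
  *-zeroˡ g (suc n) = trans (+-cong (zeroˡ _) (*-zeroˡ g n)) (+-identityˡ 0#)

  const-* : ∀ x g → (S.const x S.* g) S.≈ scale x g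
  const-* x g zero    = +-identityʳ _
  const-* x g (suc n) = trans (+-congˡ (*-zeroˡ g n)) (+-identityʳ _)

  shift-* : ∀ f g → (shift f S.* g) S.≈ shift (f S.* g)
  shift-* f g zero    = trans (+-identityʳ _) (zeroˡ _)
  shift-* f g (suc n) = trans (+-congʳ (zeroˡ _)) (+-identityˡ _)

  scale-* : ∀ x f g → (scale x f S.* g) S.≈ scale x (f S.* g)
  scale-* x f g zero = begin
    x * f 0 * g 0 + 0#   ≈⟨ +-identityʳ _ ⟩
    x * f 0 * g 0        ≈⟨ *-assoc _ _ _ ⟩
    x * (f 0 * g 0)      ≈⟨ *-congˡ (+-identityʳ _) ⟨
    x * (f 0 * g 0 + 0#) ∎
  scale-* x f g (suc n) = begin
    x * f 0 * g (suc n) + (scale x (f ∘ suc) S.* g) n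
      ≈⟨ +-cong (*-assoc _ _ _) (scale-* x (f ∘ suc) g n) ⟩
    x * (f 0 * g (suc n)) + x * ((f ∘ suc) S.* g) n
      ≈⟨ distribˡ _ _ _ ⟨
    x * (f 0 * g (suc n) + ((f ∘ suc) S.* g) n) ∎

  *-distribʳ-+ : ∀ h f g → ((f S.+ g) S.* h) S.≈ (f S.* h S.+ g S.* h)
  -- Every convolution sum ends in `0#`; this one is split as `0# + 0#` so that each summand
  -- receives its own.
  *-distribʳ-+ h f g zero =
    trans (+-cong (distribʳ _ _ _) (sym (+-identityˡ 0#))) (interchange _ _ _ _)
  *-distribʳ-+ h f g (suc n) =
    trans (+-cong (distribʳ _ _ _) (*-distribʳ-+ h (f ∘ suc) (g ∘ suc) n))
          (interchange _ _ _ _)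

  -- The mirror image of the definitional unfolding: the last term of the convolution is split off
  -- instead of the first, with the tail taken on the right. Commutativity compares the two ways of
  -- splitting.
  *-suc : ∀ f g n →
          (f S.* g) (suc n) ≈ (f S.* (g ∘ suc)) n + f (suc n) * g 0
  *-suc f g zero    = trans (+-congˡ (+-identityʳ _)) (+-congʳ (sym (+-identityʳ _)))
  *-suc f g (suc n) = trans (+-congˡ (*-suc (f ∘ suc) g n)) (sym (+-assoc _ _ _))

  *-comm′ : ∀ f g → (f S.* g) S.≈ (g S.* f)
  *-comm′ f g zero    = +-congʳ (*-comm _ _)
  *-comm′ f g (suc n) = begin
    f 0 * g (suc n) + ((f ∘ suc) S.* g) n
      ≈⟨ +-cong (*-comm _ _) (*-comm′ (f ∘ suc) g n) ⟩
    g (suc n) * f 0 + (g S.* (f ∘ suc)) n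
      ≈⟨ +-comm _ _ ⟩
    (g S.* (f ∘ suc)) n + g (suc n) * f 0
      ≈⟨ *-suc g f n ⟨
    (g S.* f) (suc n) ∎

  *-assoc′ : ∀ f g h → ((f S.* g) S.* h) S.≈ (f S.* (g S.* h))
  *-assoc′ f g h zero = +-congʳ (begin
    (f 0 * g 0 + 0#) * h 0 ≈⟨ *-congʳ (+-identityʳ _) ⟩
    f 0 * g 0 * h 0        ≈⟨ *-assoc _ _ _ ⟩
    f 0 * (g 0 * h 0)      ≈⟨ *-congˡ (+-identityʳ _) ⟨
    f 0 * (g 0 * h 0 + 0#) ∎)
  *-assoc′ f g h (suc n) = begin
    -- By definition the tail of `f S.* g` is `scale (f 0) (g ∘ suc) S.+ (f ∘ suc) S.*
    -- g`, so distributivity and `scale-*` reduce the claim to the tail of `f`.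
    (f 0 * g 0 + 0#) * h (suc n) + ((scale (f 0) (g ∘ suc) S.+ (f ∘ suc) S.* g) S.* h) n
      ≈⟨ +-cong (*-congʳ (+-identityʳ _))
                (*-distribʳ-+ h (scale (f 0) (g ∘ suc)) ((f ∘ suc) S.* g) n) ⟩
    f 0 * g 0 * h (suc n) + ((scale (f 0) (g ∘ suc) S.* h) n + (((f ∘ suc) S.* g) S.* h) n)
      ≈⟨ +-cong (*-assoc _ _ _)
                (+-cong (scale-* (f 0) (g ∘ suc) h n) (*-assoc′ (f ∘ suc) g h n)) ⟩
    f 0 * (g 0 * h (suc n)) + (f 0 * ((g ∘ suc) S.* h) n + ((f ∘ suc) S.* (g S.* h)) n)
      ≈⟨ +-assoc _ _ _ ⟨
    f 0 * (g 0 * h (suc n)) + f 0 * ((g ∘ suc) S.* h) n + ((f ∘ suc) S.* (g S.* h)) n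
      ≈⟨ +-congʳ (distribˡ _ _ _) ⟨
    f 0 * (g S.* h) (suc n) + ((f ∘ suc) S.* (g S.* h)) n ∎

  *-identityˡ′ : ∀ f → (S.1# S.* f) S.≈ f
  *-identityˡ′ f n = trans (const-* 1# f n) (*-identityˡ _)

  powerSeries-isCommutativeRing : IsCommutativeRing S._≈_ S._+_ S._*_ S.-_ S.0# S.1#
  powerSeries-isCommutativeRing = record
    { isRing = record
      { +-isAbelianGroup = record
        { isGroup = record
          { isMonoid = record
            { isSemigroup = record
              { isMagma = record
                { isEquivalence = record
                  { refl  = λ _ → refl
                  ; sym   = λ p n → sym (p n)
                  ; trans = λ p q n → trans (p n) (q n)
                  }
                ; ∙-cong = λ p q n → +-cong (p n) (q n)
                }
              ; assoc = λ f g h n → +-assoc _ _ _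
              }
            ; identity = (λ f n → +-identityˡ _) , (λ f n → +-identityʳ _)
            }
          ; inverse = (λ f n → -‿inverseˡ _) , (λ f n → -‿inverseʳ _)
          ; ⁻¹-cong = λ p n → -‿cong (p n)
          }
        ; comm = λ f g n → +-comm _ _
        }
      ; *-cong = λ {f} {f′} {g} {g′} → *-cong′ {f} {f′} {g} {g′}
      ; *-assoc = *-assoc′
      ; *-identity = *-identityˡ′
                   , (λ f n → trans (*-comm′ f S.1# n) (*-identityˡ′ f n))
      ; distrib = (λ h f g n → trans (*-comm′ h (f S.+ g) n)
                    (trans (*-distribʳ-+ h f g n) (+-cong (*-comm′ f h n) (*-comm′ g h n))))
                , *-distribʳ-+
      }
    ; *-comm = *-comm′
    }

  powerSeriesRing : CommutativeRing a ℓ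
  powerSeriesRing = record { isCommutativeRing = powerSeries-isCommutativeRing }

  const-cong : ∀ {x y} → x ≈ y → S.const x S.≈ S.const y
  const-cong x≈y zero    = x≈y
  const-cong x≈y (suc n) = refl

  const-isRingHomomorphism :
    RingMorphisms.IsRingHomomorphism rawRing S.rawRing S.const
  const-isRingHomomorphism = record
    { isSemiringHomomorphism = record
      { isNearSemiringHomomorphism = record
        { +-isMonoidHomomorphism = record
          { isMagmaHomomorphism = record
            { isRelHomomorphism = record { cong = const-cong }
            ; homo = λ where
                x y zero    → refl
                x y (suc n) → sym (+-identityˡ 0#)
            }
          ; ε-homo = λ where
              zero    → refl
              (suc n) → refl
          }
        ; *-homo = λ where
            x y zero    → sym (const-* x (S.const y) 0)
            x y (suc n) → sym (trans (const-* x (S.const y) (suc n)) (zeroʳ x))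
        }
      ; 1#-homo = λ _ → refl
      }
    ; -‿homo = λ where
        x zero    → refl
        x (suc n) → sym -0#≈0#
    }

  z-* : ∀ f → (S.z S.* f) S.≈ shift f
  z-* f zero    = trans (+-identityʳ _) (zeroˡ _)
  z-* f (suc n) = begin
    0# * f (suc n) + ((S.z ∘ suc) S.* f) n ≈⟨ +-congʳ (zeroˡ _) ⟩
    0# + ((S.z ∘ suc) S.* f) n             ≈⟨ +-identityˡ _ ⟩
    ((S.z ∘ suc) S.* f) n                  ≈⟨ *-cong′ {g = f} z∘suc (λ _ → refl) n ⟩
    (S.1# S.* f) n                         ≈⟨ *-identityˡ′ f n ⟩
    f n                                    ∎
    where
    z∘suc : (S.z ∘ suc) S.≈ S.1#
    z∘suc zero    = refl
    z∘suc (suc n) = refl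

  -- Long division is forced: since `g` has constant term 1, the heads of `f` and `h` agree, and the
  -- tail of `f` times `g` is the remainder on which the division recurses.
  /-unique : ∀ f g h → g 0 ≈ 1# → (f S.* g) S.≈ h → f S.≈ (h S./ g)
  /-unique f g h g₀≈1 fg≈h = go f h fg≈h
    where
    head : ∀ f h → (f S.* g) S.≈ h → f 0 ≈ h 0
    head f h fg≈h = begin
      f 0            ≈⟨ *-identityʳ _ ⟨
      f 0 * 1#       ≈⟨ *-congˡ g₀≈1 ⟨
      f 0 * g 0      ≈⟨ +-identityʳ _ ⟨
      f 0 * g 0 + 0# ≈⟨ fg≈h 0 ⟩
      h 0            ∎

    go : ∀ f h → (f S.* g) S.≈ h → f S.≈ (h S./ g)
    go f h fg≈h zero    = head f h fg≈h
    go f h fg≈h (suc n) = go (f ∘ suc) _ tail n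
      where
      tail : ∀ k → ((f ∘ suc) S.* g) k ≈ h (suc k) + - (h 0 * g (suc k))
      tail k = begin
        x                                         ≈⟨ +-identityˡ _ ⟨
        0# + x                                    ≈⟨ +-congʳ (-‿inverseʳ _) ⟨
        f 0 * g (suc k) + - (f 0 * g (suc k)) + x ≈⟨ xy∙z≈xz∙y _ _ _ ⟩
        f 0 * g (suc k) + x + - (f 0 * g (suc k))
          ≈⟨ +-cong (fg≈h (suc k)) (-‿cong (*-congʳ (head f h fg≈h))) ⟩
        h (suc k) + - (h 0 * g (suc k))           ∎
        where x = ((f ∘ suc) S.* g) k

-- Evaluation of polynomials is a ring homomorphism.

module Evaluation
  {a ℓ b ℓ′} (A : CommutativeRing a ℓ) (B : CommutativeRing b ℓ′)
  (φ : CommutativeRing.Carrier A → CommutativeRing.Carrier B)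
  (φ-isRingHomomorphism : RingMorphisms.IsRingHomomorphism
     (CommutativeRing.rawRing A) (CommutativeRing.rawRing B) φ)
  (x : CommutativeRing.Carrier B) where

  open CommutativeRing B
  open CommutativeSemigroupProperties +-commutativeSemigroup using (interchange)
  open CommutativeSemigroupProperties *-commutativeSemigroup
    using () renaming (x∙yz≈y∙xz to x*yz≈y*xz)
  open RingProperties ring using (-0#≈0#; -‿+-comm; -‿distribʳ-*)
  open SetoidReasoning setoid
  private
    module A = CommutativeRing A
    module P = Polynomial A.rawRing
    module φ = RingMorphisms.IsRingHomomorphism φ-isRingHomomorphism

  ⟦_⟧ : P.Carrier → Carrier
  ⟦_⟧ = P.eval₂ rawRing φ x

  ⟦const⟧ : ∀ y → ⟦ P.const y ⟧ ≈ φ y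
  ⟦const⟧ y = trans (+-congˡ (zeroʳ x)) (+-identityʳ _)

  ⟦0∷⟧ : ∀ p → ⟦ A.0# ∷ p ⟧ ≈ x * ⟦ p ⟧
  ⟦0∷⟧ p = trans (+-congʳ φ.0#-homo) (+-identityˡ _)

  -- Trailing zeros are ignored by `P._≈_`, so a nonempty list may represent zero. This settles the
  -- cases of `⟦⟧-cong` in which one list runs out first.
  ⟦⟧-zero : ∀ p → p P.≈ [] → ⟦ p ⟧ ≈ 0#
  ⟦⟧-zero []      p≈0 = refl
  ⟦⟧-zero (y ∷ p) p≈0 = begin
    φ y + x * ⟦ p ⟧ ≈⟨ +-cong (trans (φ.⟦⟧-cong (p≈0 0)) φ.0#-homo)
                              (*-congˡ (⟦⟧-zero p (p≈0 ∘ suc))) ⟩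
    0# + x * 0#     ≈⟨ +-identityˡ _ ⟩
    x * 0#          ≈⟨ zeroʳ x ⟩
    0#              ∎

  ⟦⟧-cong : ∀ {p q} → p P.≈ q → ⟦ p ⟧ ≈ ⟦ q ⟧
  ⟦⟧-cong {[]}    {q}     p≈q = sym (⟦⟧-zero q (λ n → A.sym (p≈q n)))
  ⟦⟧-cong {y ∷ p} {[]}    p≈q = ⟦⟧-zero (y ∷ p) p≈q
  ⟦⟧-cong {y ∷ p} {w ∷ q} p≈q =
    +-cong (φ.⟦⟧-cong (p≈q 0)) (*-congˡ (⟦⟧-cong {p} {q} (p≈q ∘ suc)))

  +-homo : ∀ p q → ⟦ p P.+ q ⟧ ≈ ⟦ p ⟧ + ⟦ q ⟧
  +-homo []      q       = sym (+-identityˡ _)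
  +-homo (y ∷ p) []      = sym (+-identityʳ _)
  +-homo (y ∷ p) (w ∷ q) = begin
    φ (y A.+ w) + x * ⟦ p P.+ q ⟧             ≈⟨ +-cong (φ.+-homo y w) (*-congˡ (+-homo p q)) ⟩
    (φ y + φ w) + x * (⟦ p ⟧ + ⟦ q ⟧)         ≈⟨ +-congˡ (distribˡ _ _ _) ⟩
    (φ y + φ w) + (x * ⟦ p ⟧ + x * ⟦ q ⟧)     ≈⟨ interchange _ _ _ _ ⟩
    (φ y + x * ⟦ p ⟧) + (φ w + x * ⟦ q ⟧)     ∎

  -‿homo : ∀ p → ⟦ P.- p ⟧ ≈ - ⟦ p ⟧
  -‿homo []      = sym -0#≈0#
  -‿homo (y ∷ p) = begin
    φ (A.- y) + x * ⟦ P.- p ⟧ ≈⟨ +-cong (φ.-‿homo y) (*-congˡ (-‿homo p)) ⟩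
    - φ y + x * - ⟦ p ⟧       ≈⟨ +-congˡ (-‿distribʳ-* _ _) ⟨
    - φ y + - (x * ⟦ p ⟧)     ≈⟨ -‿+-comm _ _ ⟩
    - (φ y + x * ⟦ p ⟧)       ∎

  ⟦scale⟧ : ∀ y p → ⟦ map (y A.*_) p ⟧ ≈ φ y * ⟦ p ⟧
  ⟦scale⟧ y []      = sym (zeroʳ _)
  ⟦scale⟧ y (w ∷ p) = begin
    φ (y A.* w) + x * ⟦ map (y A.*_) p ⟧ ≈⟨ +-cong (φ.*-homo y w) (*-congˡ (⟦scale⟧ y p)) ⟩
    φ y * φ w + x * (φ y * ⟦ p ⟧)        ≈⟨ +-congˡ (x*yz≈y*xz _ _ _) ⟩
    φ y * φ w + φ y * (x * ⟦ p ⟧)        ≈⟨ distribˡ _ _ _ ⟨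
    φ y * (φ w + x * ⟦ p ⟧)              ∎

  *-homo : ∀ p q → ⟦ p P.* q ⟧ ≈ ⟦ p ⟧ * ⟦ q ⟧
  *-homo []      q = sym (zeroˡ _)
  *-homo (y ∷ p) q = begin
    ⟦ map (y A.*_) q P.+ (A.0# ∷ (p P.* q)) ⟧       ≈⟨ +-homo (map (y A.*_) q) _ ⟩
    ⟦ map (y A.*_) q ⟧ + ⟦ A.0# ∷ (p P.* q) ⟧       ≈⟨ +-cong (⟦scale⟧ y q) (⟦0∷⟧ (p P.* q)) ⟩
    φ y * ⟦ q ⟧ + x * ⟦ p P.* q ⟧                   ≈⟨ +-congˡ (*-congˡ (*-homo p q)) ⟩
    φ y * ⟦ q ⟧ + x * (⟦ p ⟧ * ⟦ q ⟧)               ≈⟨ +-congˡ (*-assoc _ _ _) ⟨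
    φ y * ⟦ q ⟧ + x * ⟦ p ⟧ * ⟦ q ⟧                 ≈⟨ distribʳ _ _ _ ⟨
    (φ y + x * ⟦ p ⟧) * ⟦ q ⟧                       ∎

  ⟦⟧-isRingHomomorphism : RingMorphisms.IsRingHomomorphism P.rawRing rawRing ⟦_⟧
  ⟦⟧-isRingHomomorphism = record
    { isSemiringHomomorphism = record
      { isNearSemiringHomomorphism = record
        { +-isMonoidHomomorphism = record
          { isMagmaHomomorphism = record
            { isRelHomomorphism = record { cong = λ {p} {q} → ⟦⟧-cong {p} {q} }
            ; homo = +-homo
            }
          ; ε-homo = refl
          }
        ; *-homo = *-homo
        }
      ; 1#-homo = trans (⟦const⟧ A.1#) φ.1#-homo
      }
    ; -‿homo = -‿homo
    }

  ⟦indeterminate⟧ : ⟦ P.indeterminate ⟧ ≈ x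
  ⟦indeterminate⟧ = begin
    ⟦ P.indeterminate ⟧   ≈⟨ ⟦0∷⟧ (P.const A.1#) ⟩
    x * ⟦ P.const A.1# ⟧  ≈⟨ *-congˡ (trans (⟦const⟧ A.1#) φ.1#-homo) ⟩
    x * 1#                ≈⟨ *-identityʳ x ⟩
    x                     ∎

-- Extending a homomorphism from A to B⟦z⟧ to one from A⟦z⟧ to B⟦z⟧.

module Extension
  {a ℓ b ℓ′} (A : RawRing a ℓ) (B : CommutativeRing b ℓ′)
  (σ : RawRing.Carrier A → PowerSeries.Carrier (CommutativeRing.rawRing B))
  (σ-isRingHomomorphism : RingMorphisms.IsRingHomomorphism
     A (PowerSeries.rawRing (CommutativeRing.rawRing B)) σ) where

  open CommutativeRing B
  open CommutativeSemigroupProperties +-commutativeSemigroup using (interchange)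
  open RingProperties ring using (-‿+-comm)
  open PowerSeriesProperties B
  private
    module A = RawRing A
    module S = PowerSeries rawRing
    module K = PowerSeries A
    module σ = RingMorphisms.IsRingHomomorphism σ-isRingHomomorphism
    module SR = CommutativeRing powerSeriesRing

  -- The series Σ zⁱ σ(Fᵢ).
  extend : K.Carrier → S.Carrier
  extend F zero    = σ (F 0) 0
  extend F (suc n) = σ (F 0) (suc n) + extend (F ∘ suc) n

  -- The term with i = 0 is split off and one factor z is taken out of all others. Since σ(Fᵢ) is
  -- multiplied by zⁱ, only the terms with i at most n reach coefficient n, so the infinite sum
  -- makes sense.
  extend-unfold : ∀ F → extend F S.≈ (σ (F 0) S.+ shift (extend (F ∘ suc)))
  extend-unfold F zero    = sym (+-identityʳ _)
  extend-unfold F (suc n) = refl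

  extend-cong : ∀ {F G} → F K.≈ G → extend F S.≈ extend G
  extend-cong F≈G zero    = σ.⟦⟧-cong (F≈G 0) 0
  extend-cong F≈G (suc n) = +-cong (σ.⟦⟧-cong (F≈G 0) (suc n)) (extend-cong (F≈G ∘ suc) n)

  extend-+ : ∀ F G → extend (F K.+ G) S.≈ (extend F S.+ extend G)
  extend-+ F G zero    = σ.+-homo (F 0) (G 0) 0
  extend-+ F G (suc n) =
    trans (+-cong (σ.+-homo (F 0) (G 0) (suc n)) (extend-+ (F ∘ suc) (G ∘ suc) n))
          (interchange _ _ _ _)

  extend-‿ : ∀ F → extend (K.- F) S.≈ (S.- extend F)
  extend-‿ F zero    = σ.-‿homo (F 0) 0
  extend-‿ F (suc n) =
    trans (+-cong (σ.-‿homo (F 0) (suc n)) (extend-‿ (F ∘ suc) n)) (-‿+-comm _ _)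

  extend-0 : extend K.0# S.≈ S.0#
  extend-0 zero    = σ.0#-homo 0
  extend-0 (suc n) = trans (+-cong (σ.0#-homo (suc n)) (extend-0 n)) (+-identityˡ 0#)

  extend-const : ∀ x → extend (K.const x) S.≈ σ x
  extend-const x zero    = refl
  extend-const x (suc n) = trans (+-congˡ (extend-0 n)) (+-identityʳ _)

  extend-z : extend K.z S.≈ S.z
  extend-z zero    = σ.0#-homo 0
  extend-z (suc n) = trans (+-cong (σ.0#-homo (suc n)) (lemma n)) (trans (+-identityˡ _) (1≈z n))
    where
    -- `K.z ∘ suc` and `K.const A.1#` agree definitionally at each index in constructor form.
    -- Splitting on `n` exposes this without reflexivity in `A`, which is only a raw ring.
    z∘suc : ∀ n → extend (K.z ∘ suc) n ≈ extend (K.const A.1#) n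
    z∘suc zero    = refl
    z∘suc (suc n) = refl

    lemma : ∀ n → extend (K.z ∘ suc) n ≈ S.1# n
    lemma n = trans (z∘suc n) (trans (extend-const A.1# n) (σ.1#-homo n))

    1≈z : ∀ n → S.1# n ≈ S.z (suc n)
    1≈z zero    = refl
    1≈z (suc n) = refl

  *-shift : ∀ f g → (f S.* shift g) S.≈ shift (f S.* g)
  *-shift f g n = trans (*-comm′ f (shift g) n) (trans (shift-* g f n) (swap n))
    where
    swap : shift (g S.* f) S.≈ shift (f S.* g)
    swap zero    = refl
    swap (suc n) = *-comm′ g f n

  -- Both sides satisfy the same recursion: a head `σ x S.* σ (G 0)` plus z times the same claim for
  -- the tail of `G`. It serves as the step for one coefficient of the left factor in `extend-*`.
  extend-scale : ∀ x G → extend (λ n → x A.* G n) S.≈ (σ x S.* extend G)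
  extend-scale x G n = trans (lhs n) (sym (rhs n))
    where
    rhs : (σ x S.* extend G) S.≈
          (σ x S.* σ (G 0) S.+ shift (σ x S.* extend (G ∘ suc)))
    rhs n = trans (*-cong′ {σ x} {σ x} (λ _ → refl) (extend-unfold G) n)
      (trans (SR.distribˡ (σ x) (σ (G 0)) (shift (extend (G ∘ suc))) n)
             (+-congˡ (*-shift (σ x) (extend (G ∘ suc)) n)))

    lhs : extend (λ n → x A.* G n) S.≈
          (σ x S.* σ (G 0) S.+ shift (σ x S.* extend (G ∘ suc)))
    lhs zero    = trans (σ.*-homo x (G 0) 0) (sym (+-identityʳ _))
    lhs (suc n) = +-cong (σ.*-homo x (G 0) (suc n)) (extend-scale x (G ∘ suc) n)

  -- Induction on the index along FG = F₀G + zF′G, where F′ is the tail of F: `extend-scale` treats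
  -- the first summand and the induction hypothesis the second.
  extend-* : ∀ F G → extend (F K.* G) S.≈ (extend F S.* extend G)
  extend-* F G n = trans (lhs n) (sym (rhs n))
    where
    rhs : (extend F S.* extend G) S.≈
          (σ (F 0) S.* extend G S.+ shift (extend (F ∘ suc) S.* extend G))
    rhs n = trans (*-cong′ {g = extend G} (extend-unfold F) (λ _ → refl) n)
      (trans (*-distribʳ-+ (extend G) (σ (F 0)) (shift (extend (F ∘ suc))) n)
             (+-congˡ (shift-* (extend (F ∘ suc)) (extend G) n)))

    -- The `A.0#` ends the convolution sum. No ring law is available in `A`, so it is removed only
    -- after applying `σ`.
    head : ∀ n → σ (F 0 A.* G 0 A.+ A.0#) n ≈ σ (F 0 A.* G 0) n
    head n = trans (σ.+-homo (F 0 A.* G 0) A.0# n)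
      (trans (+-congˡ (σ.0#-homo n)) (+-identityʳ _))

    lhs : extend (F K.* G) S.≈
          (σ (F 0) S.* extend G S.+ shift (extend (F ∘ suc) S.* extend G))
    lhs zero = trans (trans (head 0) (extend-scale (F 0) G 0)) (sym (+-identityʳ _))
    lhs (suc n) =
      trans (+-cong (head (suc n))
               (trans (extend-+ (λ k → F 0 A.* G (suc k)) ((F ∘ suc) K.* G) n)
                      (+-congˡ (extend-* (F ∘ suc) G n))))
      -- After reassociation the first two summands are, by definition of `extend`, the coefficient
      -- at `suc n` of `extend (λ k → F 0 A.* G k)`.
      (trans (sym (+-assoc _ _ _)) (+-congʳ (extend-scale (F 0) G (suc n))))

-- The kernel method as an identity in a commutative ring.

module _ {c ℓ} (C : CommutativeRing c ℓ) where
  open CommutativeRing C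
  open GroupProperties +-group using (∙-cancelˡ)
  open RingProperties ring using (-‿distribʳ-*)
  open SetoidReasoning setoid

  -- Substituting `w * d + m₀` for `m` makes the coefficient of `d` on the right equal to the right
  -- side of the kernel equation, that is, to `w`. The term `w * d` then occurs on both sides and
  -- cancels additively, without division by `d`.
  kernel-elimination :
    ∀ {z q₀ q₁ q₂ m d m₀ w} →
    m ≈ q₀ + z * m * q₁ + z * d * q₂ →
    m - m₀ ≈ w * d →
    w ≈ z * q₂ + z * w * q₁ →
    m₀ * (1# - z * q₁) ≈ q₀
  kernel-elimination {z} {q₀} {q₁} {q₂} {m} {d} {m₀} {w} equation quotient kernel = begin
    m₀ * (1# - z * q₁)                      ≈⟨ distribˡ _ _ _ ⟩
    m₀ * 1# + m₀ * - (z * q₁)               ≈⟨ +-cong (*-identityʳ _) (sym (-‿distribʳ-* _ _)) ⟩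
    m₀ - m₀ * (z * q₁)                      ≈⟨ +-congʳ m₀≈ ⟩
    q₀ + m₀ * (z * q₁) - m₀ * (z * q₁)      ≈⟨ +-assoc _ _ _ ⟩
    q₀ + (m₀ * (z * q₁) - m₀ * (z * q₁))    ≈⟨ +-congˡ (-‿inverseʳ _) ⟩
    q₀ + 0#                                 ≈⟨ +-identityʳ _ ⟩
    q₀                                      ∎
    where
    open RingSolver commutativeSemiring using (solve; _:=_; _:+_; _:*_)

    -- The subtraction is moved across because the solver below works in a commutative semiring.
    m≈ : m ≈ w * d + m₀
    m≈ = begin
      m                ≈⟨ +-identityʳ _ ⟨
      m + 0#           ≈⟨ +-congˡ (-‿inverseˡ m₀) ⟨
      m + (- m₀ + m₀)  ≈⟨ +-assoc _ _ _ ⟨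
      m - m₀ + m₀      ≈⟨ +-congʳ quotient ⟩
      w * d + m₀       ∎

    m₀≈ : m₀ ≈ q₀ + m₀ * (z * q₁)
    m₀≈ = ∙-cancelˡ (w * d) _ _ (begin
      w * d + m₀
        ≈⟨ m≈ ⟨
      m
        ≈⟨ equation ⟩
      q₀ + z * m * q₁ + z * d * q₂
        ≈⟨ +-congʳ (+-congˡ (*-congʳ (*-congˡ m≈))) ⟩
      q₀ + z * (w * d + m₀) * q₁ + z * d * q₂
        ≈⟨ solve 7 (λ z q₀ q₁ q₂ d m₀ w →
             q₀ :+ z :* (w :* d :+ m₀) :* q₁ :+ z :* d :* q₂ :=
             (z :* q₂ :+ z :* w :* q₁) :* d :+ (q₀ :+ m₀ :* (z :* q₁)))
             refl z q₀ q₁ q₂ d m₀ w ⟩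
      (z * q₂ + z * w * q₁) * d + (q₀ + m₀ * (z * q₁))
        ≈⟨ +-congʳ (*-congʳ kernel) ⟨
      w * d + (q₀ + m₀ * (z * q₁))
        ∎)

-- Substituting a series u(z) for the catalytic variable.

module Substitution {c ℓ₁ ℓ₂} (R : OrderedCommutativeRing c ℓ₁ ℓ₂)
  (u : PowerSeries.Carrier (OrderedCommutativeRing.rawRing R)) where

  open OrderedCommutativeRing R
  open Catalytic R
  private
    module K = R[u]⟦z⟧
    module S = R⟦z⟧
    module Series = PowerSeriesProperties commutativeRing

  open Evaluation commutativeRing Series.powerSeriesRing S.const
    Series.const-isRingHomomorphism u public
  open Extension R[u].rawRing commutativeRing ⟦_⟧ ⟦⟧-isRingHomomorphism public

  -- Horner evaluation in `substitute` multiplies the remaining polynomial by z at each step, while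
  -- `extend` shifts the remaining series; `z-*` identifies the two recursions.
  extend-toSeries : ∀ Q → extend (toSeries Q) S.≈ substitute Q u
  extend-toSeries []      = extend-0
  extend-toSeries (p ∷ Q) n =
    trans (extend-unfold (toSeries (p ∷ Q)) n)
          (+-congˡ (trans (shifted n) (sym (Series.z-* (substitute Q u) n))))
    where
    shifted : Series.shift (extend (toSeries Q)) S.≈ Series.shift (substitute Q u)
    shifted zero    = refl
    shifted (suc n) = extend-toSeries Q n

  extend-constant-in-u : ∀ f → extend (constant-in-u f) S.≈ f
  extend-constant-in-u f zero    = ⟦const⟧ (f 0) 0
  extend-constant-in-u f (suc n) =
    trans (+-cong (⟦const⟧ (f 0) (suc n)) (extend-constant-in-u (f ∘ suc) n))
          (+-identityˡ _)

  -- This is the image under `extend` of the identity u ΔF(z,u) = F(z,u) - F(z,0): the indeterminate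
  -- goes to the series `u`, and F(z,0) is fixed.
  extend-Δ : ∀ F → (extend F S.- at-u=0 F) S.≈ (u S.* extend (Δ F))
  extend-Δ F n = begin
    extend F n - at-u=0 F n
      ≈⟨ +-congˡ (-‿cong (extend-constant-in-u (at-u=0 F) n)) ⟨
    extend F n - extend F₀ n
      ≈⟨ +-congˡ (extend-‿ F₀ n) ⟨
    extend F n + extend (K.- F₀) n
      ≈⟨ extend-+ F (K.- F₀) n ⟨
    extend (F K.- F₀) n
      ≈⟨ extend-cong (Correctness.Δ-correct R F) n ⟨
    -- The indeterminate multiplies each coefficient in z separately, so `extend-scale` applies
    -- directly.
    extend (λ k → R[u].indeterminate R[u].* Δ F k) n
      ≈⟨ extend-scale R[u].indeterminate (Δ F) n ⟩
    (⟦ R[u].indeterminate ⟧ S.* extend (Δ F)) n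
      ≈⟨ Series.*-cong′ {g = extend (Δ F)} ⟦indeterminate⟧ (λ _ → refl) n ⟩
    (u S.* extend (Δ F)) n
      ∎
    where
    open SetoidReasoning setoid
    F₀ = constant-in-u (at-u=0 F)

  -- The last two terms of the functional equation have this shape, with `F` equal to `M` and to
  -- `Δ M`.
  extend-z*F*Q : ∀ F Q → extend (K.z K.* F K.* toSeries Q) S.≈
                         (S.z S.* extend F S.* substitute Q u)
  extend-z*F*Q F Q n =
    trans (extend-* (K.z K.* F) (toSeries Q) n)
      (Series.*-cong′
        (λ k → trans (extend-* K.z F k)
                 (Series.*-cong′ {g = extend F} extend-z (λ _ → refl) k))
        (extend-toSeries Q) n)

-- The formula for M(z,0).

proposition1 : ∀ {c ℓ₁ ℓ₂} (R : OrderedCommutativeRing c ℓ₁ ℓ₂) →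
    let open OrderedCommutativeRing R
        open Catalytic R
        module K = R[u]⟦z⟧
        module S = R⟦z⟧
    in
    (Q₀ Q₁ Q₂ : R[u][z].Carrier) →
    NonNegative Q₀ → NonNegative Q₁ → NonNegative Q₂ →
    (M : K.Carrier) →
    M K.≈ toSeries Q₀ K.+ K.z K.* M K.* toSeries Q₁ K.+ K.z K.* Δ M K.* toSeries Q₂ →
    (u : S.Carrier) →
    u S.≈ S.z S.* substitute Q₂ u S.+ S.z S.* u S.* substitute Q₁ u →
    u 0 ≈ 0# →
    at-u=0 M S.≈ substitute Q₀ u S./ (S.1# S.- S.z S.* substitute Q₁ u)
proposition1 R Q₀ Q₁ Q₂ _ _ _ M M-equation u u-equation _ =
  -- The denominator has constant term 1, so it suffices to show that M(z,0) times the denominator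
  -- is the numerator.
  Series./-unique (at-u=0 M) _ (substitute Q₀ u)
    (Correctness.1-zf-constant-term R (substitute Q₁ u))
    -- Here `m`, `d`, `m₀` and `w` are `extend M`, `extend (Δ M)`, `at-u=0 M` and `u`.
    (kernel-elimination Series.powerSeriesRing {z = S.z} {q₂ = substitute Q₂ u}
      equation (extend-Δ M) u-equation)
  where
  open OrderedCommutativeRing R
  open Catalytic R
  module K = R[u]⟦z⟧
  module S = R⟦z⟧
  module Series = PowerSeriesProperties commutativeRing
  open Substitution R u

  zMQ₁ zΔMQ₂ : K.Carrier
  zMQ₁  = K.z K.* M K.* toSeries Q₁
  zΔMQ₂ = K.z K.* Δ M K.* toSeries Q₂

  equation : extend M S.≈ substitute Q₀ u S.+ S.z S.* extend M S.* substitute Q₁ u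
                            S.+ S.z S.* extend (Δ M) S.* substitute Q₂ u
  equation n =
    trans (extend-cong M-equation n)
    (trans (extend-+ (toSeries Q₀ K.+ zMQ₁) zΔMQ₂ n)
      (+-cong (trans (extend-+ (toSeries Q₀) zMQ₁ n)
                     (+-cong (extend-toSeries Q₀ n) (extend-z*F*Q M Q₁ n)))
              (extend-z*F*Q (Δ M) Q₂ n)))
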